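{- The problems GVC, GVC1 and GVC2 are pairwise equivalent: for any two of them, every instance of one (on a graph $G=(V,E)$) can be formulated as an instance of the other on the same graph, in such a way that an optimal solution of the new instance is an optimal solution of the original instance.
   Context: Let $G=(V,E)$ be a graph with $V=\{1,\dots,n\}$. Each vertex $i$ has a real weight $c_i$ and each edge $(i,j)\in E$ has three real weights $q^0_{ij},q^1_{ij},q^2_{ij}$. For $U\subseteq V$ let $E_0(U)=\{(i,j)\in E: i,j\notin U\}$, $E_1(U)=\{(i,j)\in E:$ exactly one of $i,j$ lies in $U\}$, $E_2(U)=\{(i,j)\in E: i,j\in U\}$, and $f(U)=\sum_{i\in U}c_i+\sum_{E_0(U)}q^0_{ij}+\sum_{E_1(U)}q^1_{ij}+\sum_{E_2(U)}q^2_{ij}$ (with $f(\emptyset)=\sum_{E}q^0_{ij}$). The generalized vertex cover problem (GVC) is to find $U\subseteq V$ minimizing $f(U)$. GVC1 is the special case of GVC with $q^1_{ij}=q^2_{ij}=0$ for all edges; GVC2 is the special case with $q^0_{ij}=q^1_{ij}=0$ for all edges (weights otherwise arbitrary reals). Two problems are called equivalent if each can be formulated as the other in the sense that from an optimal solution of the formulated instance an optimal solution of the original instance can be recovered. -}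

module Defs where

open import Algebra.Bundles.Raw using (RawMonoid)
import Algebra.Definitions.RawMonoid as RawMonoidDefs
open import Data.Bool.Base using (Bool; if_then_else_; not; _∧_; _xor_)
open import Data.Fin.Base as Fin using (Fin)
open import Data.Fin.Subset using (Subset)
open import Data.Nat.Base as ℕ using (ℕ)
import Data.Nat.Properties as ℕₚ
open import Data.Product using (_×_; _,_; ∃; proj₁; proj₂)
open import Data.Rational.Base as ℚ using (ℚ; 0ℚ; ½)
import Data.Rational.Properties as ℚₚ
open import Data.Unit.Base using (⊤)
open import Data.Vec.Base using (lookup; tabulate)
open import Data.Vec.Functional using (Vector)
open import Function.Definitions using (Injective)
open import Level using (0ℓ)
open import Relation.Binary.PropositionalEquality
  using (_≡_; sym; trans; cong; subst; module ≡-Reasoning)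

-- The real numbers are Cauchy sequences of rationals, with equality given by
-- the setoid relation _≈_ instead of a quotient. Only the ordered additive
-- structure occurs in the objective function.

IsCauchy : (ℕ → ℚ) → Set
IsCauchy x = ∀ ε → 0ℚ ℚ.< ε →
  ∃ λ N → ∀ m n → N ℕ.≤ m → N ℕ.≤ n → ℚ.∣ x m ℚ.- x n ∣ ℚ.< ε

record ℝ : Set where
  constructor mkℝ
  field
    seq    : ℕ → ℚ
    cauchy : IsCauchy seq

open ℝ public

infix 4 _≈_ _≤_
infixl 6 _+_

_≈_ : ℝ → ℝ → Set
x ≈ y = ∀ ε → 0ℚ ℚ.< ε → ∃ λ N → ∀ n → N ℕ.≤ n → ℚ.∣ seq x n ℚ.- seq y n ∣ ℚ.< ε

-- The slack ε makes _≤_ respect _≈_: termwise comparison would not.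
_≤_ : ℝ → ℝ → Set
x ≤ y = ∀ ε → 0ℚ ℚ.< ε → ∃ λ N → ∀ n → N ℕ.≤ n → seq x n ℚ.< seq y n ℚ.+ ε

0ℝ : ℝ
0ℝ = mkℝ (λ _ → 0ℚ) λ ε 0<ε → 0 , λ _ _ _ _ → 0<ε

private
  half-pos : ∀ ε → 0ℚ ℚ.< ε → 0ℚ ℚ.< ½ ℚ.* ε
  half-pos ε 0<ε = subst (ℚ._< ½ ℚ.* ε) (ℚₚ.*-zeroʳ ½) (ℚₚ.*-monoʳ-<-pos ½ 0<ε)

  halves : ∀ ε → ½ ℚ.* ε ℚ.+ ½ ℚ.* ε ≡ ε
  halves ε = trans (sym (ℚₚ.*-distribʳ-+ ε ½ ½)) (ℚₚ.*-identityˡ ε)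

  interchange : ∀ a b c d → (a ℚ.+ b) ℚ.- (c ℚ.+ d) ≡ (a ℚ.- c) ℚ.+ (b ℚ.- d)
  interchange a b c d = begin
    (a ℚ.+ b) ℚ.- (c ℚ.+ d)             ≡⟨ cong ((a ℚ.+ b) ℚ.+_) (ℚₚ.neg-distrib-+ c d) ⟩
    (a ℚ.+ b) ℚ.+ (ℚ.- c ℚ.+ ℚ.- d)     ≡⟨ ℚₚ.+-assoc a b _ ⟩
    a ℚ.+ (b ℚ.+ (ℚ.- c ℚ.+ ℚ.- d))     ≡⟨ cong (a ℚ.+_) (ℚₚ.+-assoc b (ℚ.- c) (ℚ.- d)) ⟨
    a ℚ.+ ((b ℚ.+ ℚ.- c) ℚ.+ ℚ.- d)     ≡⟨ cong (λ z → a ℚ.+ (z ℚ.+ ℚ.- d)) (ℚₚ.+-comm b (ℚ.- c)) ⟩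
    a ℚ.+ ((ℚ.- c ℚ.+ b) ℚ.+ ℚ.- d)     ≡⟨ cong (a ℚ.+_) (ℚₚ.+-assoc (ℚ.- c) b (ℚ.- d)) ⟩
    a ℚ.+ (ℚ.- c ℚ.+ (b ℚ.+ ℚ.- d))     ≡⟨ ℚₚ.+-assoc a (ℚ.- c) _ ⟨
    (a ℚ.- c) ℚ.+ (b ℚ.- d)             ∎
    where open ≡-Reasoning

_+_ : ℝ → ℝ → ℝ
x + y = mkℝ (λ n → seq x n ℚ.+ seq y n) λ ε 0<ε →
  let M , close-x = cauchy x (½ ℚ.* ε) (half-pos ε 0<ε)
      N , close-y = cauchy y (½ ℚ.* ε) (half-pos ε 0<ε)
  in M ℕ.⊔ N , λ m n ≤m ≤n →
    let open ℚₚ.≤-Reasoning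
        M≤ = ℕₚ.m≤m⊔n M N
        N≤ = ℕₚ.m≤n⊔m M N
    in begin-strict
      ℚ.∣ (seq x m ℚ.+ seq y m) ℚ.- (seq x n ℚ.+ seq y n) ∣
        ≡⟨ cong ℚ.∣_∣ (interchange (seq x m) (seq y m) (seq x n) (seq y n)) ⟩
      ℚ.∣ (seq x m ℚ.- seq x n) ℚ.+ (seq y m ℚ.- seq y n) ∣
        ≤⟨ ℚₚ.∣p+q∣≤∣p∣+∣q∣ (seq x m ℚ.- seq x n) (seq y m ℚ.- seq y n) ⟩
      ℚ.∣ seq x m ℚ.- seq x n ∣ ℚ.+ ℚ.∣ seq y m ℚ.- seq y n ∣
        <⟨ ℚₚ.+-mono-< (close-x m n (ℕₚ.≤-trans M≤ ≤m) (ℕₚ.≤-trans M≤ ≤n))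
                       (close-y m n (ℕₚ.≤-trans N≤ ≤m) (ℕₚ.≤-trans N≤ ≤n)) ⟩
      ½ ℚ.* ε ℚ.+ ½ ℚ.* ε
        ≡⟨ halves ε ⟩
      ε ∎

+-0-rawMonoid : RawMonoid 0ℓ 0ℓ
+-0-rawMonoid = record { Carrier = ℝ ; _≈_ = _≈_ ; _∙_ = _+_ ; ε = 0ℝ }

open RawMonoidDefs +-0-rawMonoid public using (sum)

sumOver : ∀ {k} → Subset k → Vector ℝ k → ℝ
sumOver S w = sum λ i → if lookup S i then w i else 0ℝ

-- A finite simple graph: an enumeration without repetition of its edges, each
-- unordered pair {i , j} being represented by (i , j) with i < j.
record Graph : Set where
  field
    #vertices #edges : ℕ
    ends     : Fin #edges → Fin #vertices × Fin #vertices
    ordered  : ∀ e → proj₁ (ends e) Fin.< proj₂ (ends e)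
    distinct : Injective _≡_ _≡_ ends

  V E : Set
  V = Fin #vertices
  E = Fin #edges

module _ (G : Graph) where
  open Graph G

  edgesBy : (Bool → Bool → Bool) → Subset #vertices → Subset #edges
  edgesBy p U = tabulate λ e →
    let i , j = ends e in p (lookup U i) (lookup U j)

  E₀ E₁ E₂ : Subset #vertices → Subset #edges
  E₀ = edgesBy λ i∈U j∈U → not i∈U ∧ not j∈U
  E₁ = edgesBy λ i∈U j∈U → i∈U xor j∈U
  E₂ = edgesBy λ i∈U j∈U → i∈U ∧ j∈U

record Weights (G : Graph) : Set where
  open Graph G
  field
    c        : V → ℝ
    q⁰ q¹ q² : E → ℝ

module _ {G : Graph} (w : Weights G) where
  open Graph G
  open Weights w

  objective : Subset #vertices → ℝ
  objective U = sumOver U c + sumOver (E₀ G U) q⁰ + sumOver (E₁ G U) q¹ + sumOver (E₂ G U) q²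

  Optimal : Subset #vertices → Set
  Optimal U = ∀ W → objective U ≤ objective W

-- A problem is given by its class of instances; the objective is common to all.
Problem : Set₁
Problem = ∀ G → Weights G → Set

GVC GVC1 GVC2 : Problem
GVC  G w = ⊤
GVC1 G w = ∀ e → Weights.q¹ w e ≈ 0ℝ × Weights.q² w e ≈ 0ℝ
GVC2 G w = ∀ e → Weights.q⁰ w e ≈ 0ℝ × Weights.q¹ w e ≈ 0ℝ

FormulatedAs : Problem → Problem → Set
FormulatedAs P Q = ∀ G (w : Weights G) → P G w →
  ∃ λ (w′ : Weights G) → Q G w′ × (∀ U → Optimal w′ U → Optimal w U)

Equivalent : Problem → Problem → Set
Equivalent P Q = FormulatedAs P Q × FormulatedAs Q P

{-# OPTIONS --safe #-}
-- Each edge cost q⁰(1-xᵢ)(1-xⱼ) + q¹(xᵢ + xⱼ - 2xᵢxⱼ) + q²xᵢxⱼ of the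
-- indicator x of U remains the same function of U up to the constant κ when
-- (q⁰ , q¹ , q²) is replaced by (q⁰ - κ , q¹ - (α + κ) , q² - (2α + κ)) and α is
-- added to the weights of both ends. The two parameters α and κ suffice to
-- annihilate either q¹ and q² or q⁰ and q¹, and adding a constant to the
-- objective does not change its minimizers.
module Submission where

open import Defs
open import Data.Bool.Base using (Bool; true; false; if_then_else_; not; _∧_; _xor_)
open import Data.Bool.Properties using (if-float)
open import Data.Fin.Base using (Fin; zero; suc)
open import Data.Fin.Properties using (_≟_)
open import Data.Fin.Subset using (Subset)
open import Data.Nat.Base using (ℕ; zero; suc)
open import Data.Product using (_×_; _,_; proj₁; proj₂)
open import Data.Rational.Base as ℚ using (ℚ; 0ℚ)
import Data.Rational.Properties as ℚₚ
open import Data.Rational.Solver using (module +-*-Solver)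
open import Data.Unit.Base using (tt)
open import Data.Vec.Base using (lookup)
open import Data.Vec.Functional using (Vector)
open import Data.Vec.Properties using (lookup∘tabulate)
open import Function.Base using (_∘_)
open import Relation.Binary.PropositionalEquality
open import Relation.Nullary.Decidable using (does)
import Algebra.Properties.CommutativeMonoid.Sum as Sum

open Sum ℚₚ.+-0-commutativeMonoid
  using (sum-syntax; sum-cong-≗; sum-replicate-zero; ∑-distrib-+; ∑-comm)

-- Subtraction and termwise comparison of Cauchy reals.

infix  8  -_
infixl 6  _-_
infixr 11 _⊙_

-_ : ℝ → ℝ
- x = mkℝ (λ n → ℚ.- seq x n) λ ε 0<ε →
  let N , close = cauchy x ε 0<ε
  in N , λ m n N≤m N≤n →
    subst (ℚ._< ε) (∣-∣-neg (seq x m) (seq x n)) (close m n N≤m N≤n)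
  where
  ∣-∣-neg : ∀ p q → ℚ.∣ p ℚ.- q ∣ ≡ ℚ.∣ ℚ.- p ℚ.- ℚ.- q ∣
  ∣-∣-neg p q = trans (sym (ℚₚ.∣-p∣≡∣p∣ (p ℚ.- q))) (cong ℚ.∣_∣ (ℚₚ.neg-distrib-+ p (ℚ.- q)))

_-_ : ℝ → ℝ → ℝ
x - y = x + - y

-- Addition and negation of reals act termwise on representatives, so real identities can be checked
-- in ℚ at each index; here `N = 0` serves for every `ε`.
≗⇒≈ : ∀ x y → seq x ≗ seq y → x ≈ y
≗⇒≈ x y x≗y ε 0<ε = 0 , λ n _ → subst (ℚ._< ε) (sym (∣x-y∣≡0 n)) 0<ε
  where
  ∣x-y∣≡0 : ∀ n → ℚ.∣ seq x n ℚ.- seq y n ∣ ≡ 0ℚ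
  ∣x-y∣≡0 n rewrite x≗y n | ℚₚ.+-inverseʳ (seq y n) = refl

-- Adding the same term of `k` on both sides preserves a strict inequality of rationals, so the `N`
-- found for `x′ ≤ y′` serves with the same `ε`. With `k` the constant by which two objectives
-- differ, this transfers optimality.
+-mono-≤-≗ : ∀ x y x′ y′ k → seq x ≗ seq (x′ + k) → seq y ≗ seq (y′ + k) → x′ ≤ y′ → x ≤ y
+-mono-≤-≗ x y x′ y′ k x≗ y≗ x′≤y′ ε 0<ε =
  let N , below = x′≤y′ ε 0<ε
  in N , λ n N≤n → begin-strict
    seq x n                          ≡⟨ x≗ n ⟩
    seq x′ n ℚ.+ seq k n             <⟨ ℚₚ.+-monoˡ-< (seq k n) (below n N≤n) ⟩
    seq y′ n ℚ.+ ε ℚ.+ seq k n       ≡⟨ solve 3 (λ a b c → a :+ b :+ c := a :+ c :+ b) refl (seq y′ n) ε (seq k n) ⟩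
    seq y′ n ℚ.+ seq k n ℚ.+ ε       ≡⟨ cong (ℚ._+ ε) (y≗ n) ⟨
    seq y n ℚ.+ ε                    ∎
  where
  open ℚₚ.≤-Reasoning
  open +-*-Solver

-- Finite sums of rationals multiplied by indicators.

_⊙_ : Bool → ℚ → ℚ
b ⊙ p = if b then p else 0ℚ

⊙-zero : ∀ b → b ⊙ 0ℚ ≡ 0ℚ
⊙-zero false = refl
⊙-zero true  = refl

⊙-distrib-+ : ∀ b p q → b ⊙ (p ℚ.+ q) ≡ b ⊙ p ℚ.+ b ⊙ q
⊙-distrib-+ false p q = refl
⊙-distrib-+ true  p q = refl

⊙-distrib-∑ : ∀ b {k} (v : Vector ℚ k) → b ⊙ (∑[ i < k ] v i) ≡ ∑[ i < k ] b ⊙ v i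
⊙-distrib-∑ false {k} v = sym (sum-replicate-zero k)
⊙-distrib-∑ true      v = refl

-- The inner factor is a Kronecker delta. Its test computes along the induction on `j`: it is false
-- off the diagonal and passes to predecessors on successors.
∑-single : ∀ {k} (x : Fin k → Bool) j p → ∑[ i < k ] x i ⊙ does (i ≟ j) ⊙ p ≡ x j ⊙ p
∑-single {suc k} x zero p = trans
  (cong (x zero ⊙ p ℚ.+_) (trans (sum-cong-≗ {k} (⊙-zero ∘ x ∘ suc)) (sum-replicate-zero k)))
  (ℚₚ.+-identityʳ _)
∑-single {suc k} x (suc j) p = trans
  (cong₂ ℚ._+_ (⊙-zero (x zero)) (∑-single (x ∘ suc) j p))
  (ℚₚ.+-identityˡ _)

seq-if : ∀ b x n → seq (if b then x else 0ℝ) n ≡ b ⊙ seq x n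
seq-if b x n = if-float (λ y → seq y n) b

seq-sum : ∀ {k} (v : Vector ℝ k) n → seq (sum v) n ≡ ∑[ i < k ] seq (v i) n
seq-sum {zero}  v n = refl
seq-sum {suc k} v n = cong (seq (v zero) n ℚ.+_) (seq-sum (v ∘ suc) n)

seq-sumOver : ∀ {k} (S : Subset k) v n →
  seq (sumOver S v) n ≡ ∑[ i < k ] lookup S i ⊙ seq (v i) n
seq-sumOver {k} S v n = trans
  (seq-sum (λ i → if lookup S i then v i else 0ℝ) n)
  (sum-cong-≗ {k} λ i → seq-if (lookup S i) (v i) n)

-- The cost of a single edge.

edgeCost : Bool → Bool → ℚ → ℚ → ℚ → ℚ
edgeCost a b p q r = (not a ∧ not b) ⊙ p ℚ.+ (a xor b) ⊙ q ℚ.+ (a ∧ b) ⊙ r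

-- For each pair of truth values exactly one of the three weights survives. It has lost `κ` plus one
-- `α` per end in the set, which is what the remaining terms give back.
edgeCost-shift : ∀ a b p q r α κ →
  edgeCost a b p q r ≡
  edgeCost a b (p ℚ.- κ) (q ℚ.- (α ℚ.+ κ)) (r ℚ.- (α ℚ.+ α ℚ.+ κ)) ℚ.+ (a ⊙ α ℚ.+ b ⊙ α) ℚ.+ κ
edgeCost-shift false false = solve 5 (λ p q r α κ →
  p :+ o :+ o := p :- κ :+ o :+ o :+ (o :+ o) :+ κ) refl
  where open +-*-Solver ; o = con 0ℚ
edgeCost-shift false true = solve 5 (λ p q r α κ →
  o :+ q :+ o := o :+ (q :- (α :+ κ)) :+ o :+ (o :+ α) :+ κ) refl
  where open +-*-Solver ; o = con 0ℚ
edgeCost-shift true false = solve 5 (λ p q r α κ →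
  o :+ q :+ o := o :+ (q :- (α :+ κ)) :+ o :+ (α :+ o) :+ κ) refl
  where open +-*-Solver ; o = con 0ℚ
edgeCost-shift true true = solve 5 (λ p q r α κ →
  o :+ o :+ r := o :+ o :+ (r :- (α :+ α :+ κ)) :+ (α :+ α) :+ κ) refl
  where open +-*-Solver ; o = con 0ℚ

-- The objective and its change under reweighting.

module _ {G : Graph} where
  open Graph G

  source target : E → V
  source = proj₁ ∘ ends
  target = proj₂ ∘ ends

  seq-sumOver-edgesBy : ∀ p U (v : E → ℝ) n →
    seq (sumOver (edgesBy G p U) v) n ≡
    ∑[ e < #edges ] p (lookup U (source e)) (lookup U (target e)) ⊙ seq (v e) n
  seq-sumOver-edgesBy p U v n = trans (seq-sumOver (edgesBy G p U) v n)
    (sum-cong-≗ λ e → cong (_⊙ seq (v e) n) (lookup∘tabulate _ e))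

  edgeCostAt : Weights G → Subset #vertices → ℕ → E → ℚ
  edgeCostAt w U n e = edgeCost (lookup U (source e)) (lookup U (target e))
    (seq (q⁰ e) n) (seq (q¹ e) n) (seq (q² e) n)
    where open Weights w

  -- Merging the three edge sums into one lets `edgeCost-shift` be applied edge by edge.
  seq-objective : ∀ (w : Weights G) U n → seq (objective w U) n ≡
    (∑[ i < #vertices ] lookup U i ⊙ seq (Weights.c w i) n) ℚ.+ (∑[ e < #edges ] edgeCostAt w U n e)
  seq-objective w U n = begin
    seq (objective w U) n
      ≡⟨ cong₂ ℚ._+_ (cong₂ ℚ._+_ (cong₂ ℚ._+_
           (seq-sumOver U c n)
           (seq-sumOver-edgesBy (λ a b → not a ∧ not b) U q⁰ n))
           (seq-sumOver-edgesBy _xor_ U q¹ n))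
           (seq-sumOver-edgesBy _∧_ U q² n) ⟩
    C ℚ.+ ∑ₑ t⁰ ℚ.+ ∑ₑ t¹ ℚ.+ ∑ₑ t²
      ≡⟨ solve 4 (λ x y z u → x :+ y :+ z :+ u := x :+ (y :+ z :+ u)) refl C (∑ₑ t⁰) (∑ₑ t¹) (∑ₑ t²) ⟩
    C ℚ.+ (∑ₑ t⁰ ℚ.+ ∑ₑ t¹ ℚ.+ ∑ₑ t²)
      ≡⟨ cong (λ s → C ℚ.+ (s ℚ.+ ∑ₑ t²)) (∑-distrib-+ t⁰ t¹) ⟨
    C ℚ.+ (∑ₑ (λ e → t⁰ e ℚ.+ t¹ e) ℚ.+ ∑ₑ t²)
      ≡⟨ cong (C ℚ.+_) (∑-distrib-+ (λ e → t⁰ e ℚ.+ t¹ e) t²) ⟨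
    C ℚ.+ ∑ₑ (edgeCostAt w U n) ∎
    where
    open ≡-Reasoning
    open +-*-Solver using (solve; _:+_; _:=_)
    open Weights w
    ∑ₑ = sum-syntax #edges
    C = ∑[ i < #vertices ] lookup U i ⊙ seq (c i) n
    t⁰ t¹ t² : E → ℚ
    t⁰ e = (not (lookup U (source e)) ∧ not (lookup U (target e))) ⊙ seq (q⁰ e) n
    t¹ e = (lookup U (source e) xor lookup U (target e)) ⊙ seq (q¹ e) n
    t² e = (lookup U (source e) ∧ lookup U (target e)) ⊙ seq (q² e) n

  -- The total of `α` over the edges incident with `i`. Each end is tested separately so that a sum
  -- over vertices splits into two delta sums per edge.
  load : (E → ℝ) → V → ℝ
  load α i = sum λ e →
    (if does (i ≟ source e) then α e else 0ℝ) + (if does (i ≟ target e) then α e else 0ℝ)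

  -- Double counting of incidences: after the sums are exchanged, the two tests of an edge pick out
  -- its source and its target.
  ∑-load : ∀ (x : V → Bool) α n →
    ∑[ i < #vertices ] x i ⊙ seq (load α i) n ≡
    ∑[ e < #edges ] (x (source e) ⊙ seq (α e) n ℚ.+ x (target e) ⊙ seq (α e) n)
  ∑-load x α n = begin
    ∑ᵥ (λ i → x i ⊙ seq (load α i) n)
      ≡⟨ sum-cong-≗ expand ⟩
    ∑ᵥ (λ i → ∑ₑ λ e → s i e ℚ.+ t i e)
      ≡⟨ ∑-comm (λ i e → s i e ℚ.+ t i e) ⟩
    ∑ₑ (λ e → ∑ᵥ λ i → s i e ℚ.+ t i e)
      ≡⟨ sum-cong-≗ (λ e → trans (∑-distrib-+ (λ i → s i e) (λ i → t i e))
           (cong₂ ℚ._+_ (∑-single x (source e) _) (∑-single x (target e) _))) ⟩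
    ∑ₑ (λ e → x (source e) ⊙ seq (α e) n ℚ.+ x (target e) ⊙ seq (α e) n) ∎
    where
    open ≡-Reasoning
    ∑ᵥ = sum-syntax #vertices
    ∑ₑ = sum-syntax #edges
    s t : V → E → ℚ
    s i e = x i ⊙ does (i ≟ source e) ⊙ seq (α e) n
    t i e = x i ⊙ does (i ≟ target e) ⊙ seq (α e) n
    expand : ∀ i → x i ⊙ seq (load α i) n ≡ ∑ₑ λ e → s i e ℚ.+ t i e
    expand i = begin
      x i ⊙ seq (load α i) n
        ≡⟨ cong (x i ⊙_) (trans
             (seq-sum (λ e → (if does (i ≟ source e) then α e else 0ℝ) + (if does (i ≟ target e) then α e else 0ℝ)) n)
             (sum-cong-≗ {#edges} λ e →
               cong₂ ℚ._+_ (seq-if (does (i ≟ source e)) (α e) n) (seq-if (does (i ≟ target e)) (α e) n))) ⟩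
      x i ⊙ ∑ₑ (λ e → does (i ≟ source e) ⊙ seq (α e) n ℚ.+ does (i ≟ target e) ⊙ seq (α e) n)
        ≡⟨ ⊙-distrib-∑ (x i) {#edges} _ ⟩
      ∑ₑ (λ e → x i ⊙ (does (i ≟ source e) ⊙ seq (α e) n ℚ.+ does (i ≟ target e) ⊙ seq (α e) n))
        ≡⟨ sum-cong-≗ {#edges} (λ e → ⊙-distrib-+ (x i) _ _) ⟩
      ∑ₑ (λ e → s i e ℚ.+ t i e) ∎

  reweight : Weights G → (α κ : E → ℝ) → Weights G
  reweight w α κ = record
    { c  = λ i → c i + load α i
    ; q⁰ = λ e → q⁰ e - κ e
    ; q¹ = λ e → q¹ e - (α e + κ e)
    ; q² = λ e → q² e - (α e + α e + κ e)
    }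
    where open Weights w

  objective-reweight : ∀ w α κ U → seq (objective w U) ≗ seq (objective (reweight w α κ) U + sum κ)
  objective-reweight w α κ U n = begin
    seq (objective w U) n
      ≡⟨ seq-objective w U n ⟩
    C ℚ.+ ∑ₑ (edgeCostAt w U n)
      ≡⟨ cong (C ℚ.+_) (sum-cong-≗ λ e → edgeCost-shift (lookup U (source e)) (lookup U (target e))
           (seq (q⁰ e) n) (seq (q¹ e) n) (seq (q² e) n) (seq (α e) n) (seq (κ e) n)) ⟩
    C ℚ.+ ∑ₑ (λ e → cost′ e ℚ.+ shift e ℚ.+ seq (κ e) n)
      ≡⟨ cong (C ℚ.+_) (trans (∑-distrib-+ (λ e → cost′ e ℚ.+ shift e) (λ e → seq (κ e) n))
           (cong (ℚ._+ K) (∑-distrib-+ cost′ shift))) ⟩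
    C ℚ.+ (∑ₑ cost′ ℚ.+ ∑ₑ shift ℚ.+ K)
      -- The share of the ends is brought next to the vertex sum, where `∑-load` turns it into
      -- vertex weights.
      ≡⟨ solve 4 (λ x y z u → x :+ (y :+ z :+ u) := x :+ z :+ y :+ u) refl C (∑ₑ cost′) (∑ₑ shift) K ⟩
    C ℚ.+ ∑ₑ shift ℚ.+ ∑ₑ cost′ ℚ.+ K
      ≡⟨ cong (λ s → C ℚ.+ s ℚ.+ ∑ₑ cost′ ℚ.+ K) (∑-load (lookup U) α n) ⟨
    C ℚ.+ ∑ᵥ (λ i → lookup U i ⊙ seq (load α i) n) ℚ.+ ∑ₑ cost′ ℚ.+ K
      ≡⟨ cong (λ s → s ℚ.+ ∑ₑ cost′ ℚ.+ K) (trans (sum-cong-≗ λ i → ⊙-distrib-+ (lookup U i) _ _)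
           (∑-distrib-+ (λ i → lookup U i ⊙ seq (c i) n) (λ i → lookup U i ⊙ seq (load α i) n))) ⟨
    ∑ᵥ (λ i → lookup U i ⊙ (seq (c i) n ℚ.+ seq (load α i) n)) ℚ.+ ∑ₑ cost′ ℚ.+ K
      ≡⟨ cong₂ ℚ._+_ (seq-objective (reweight w α κ) U n) (seq-sum κ n) ⟨
    seq (objective (reweight w α κ) U + sum κ) n ∎
    where
    open ≡-Reasoning
    open +-*-Solver using (solve; _:+_; _:=_)
    open Weights w
    ∑ᵥ = sum-syntax #vertices
    ∑ₑ = sum-syntax #edges
    C = ∑ᵥ λ i → lookup U i ⊙ seq (c i) n
    K = ∑ₑ λ e → seq (κ e) n
    cost′ shift : E → ℚ
    cost′ = edgeCostAt (reweight w α κ) U n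
    shift e = lookup U (source e) ⊙ seq (α e) n ℚ.+ lookup U (target e) ⊙ seq (α e) n

  -- The two objectives differ by `sum κ`, which is the same for `U` and for its competitor `W`.
  reweight-optimal : ∀ w α κ U → Optimal (reweight w α κ) U → Optimal w U
  reweight-optimal w α κ U opt W =
    +-mono-≤-≗ (objective w U) (objective w W) (objective w′ U) (objective w′ W) (sum κ)
      (objective-reweight w α κ U) (objective-reweight w α κ W) (opt W)
    where w′ = reweight w α κ

-- Choice of the parameters and the equivalences.

GVC⇒GVC1 : FormulatedAs GVC GVC1
GVC⇒GVC1 G w _ =
  w′
  , (λ e → ≗⇒≈ (Weights.q¹ w′ e) 0ℝ (λ n → q¹-vanishes (seq (q¹ e) n) (seq (q² e) n))
         , ≗⇒≈ (Weights.q² w′ e) 0ℝ (λ n → q²-vanishes (seq (q¹ e) n) (seq (q² e) n)))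
  , reweight-optimal w α κ
  where
  open Graph G
  open Weights w
  open +-*-Solver
  α κ : E → ℝ
  -- The unique solution of α + κ = q¹ and 2α + κ = q²: subtracting gives α, and the first equation
  -- then gives κ.
  α e = q² e - q¹ e
  κ e = q¹ e - α e
  w′ = reweight w α κ
  q¹-vanishes : ∀ q r → q ℚ.- (r ℚ.- q ℚ.+ (q ℚ.- (r ℚ.- q))) ≡ 0ℚ
  q¹-vanishes = solve 2 (λ q r → q :- (r :- q :+ (q :- (r :- q))) := con 0ℚ) refl
  q²-vanishes : ∀ q r → r ℚ.- (r ℚ.- q ℚ.+ (r ℚ.- q) ℚ.+ (q ℚ.- (r ℚ.- q))) ≡ 0ℚ
  q²-vanishes = solve 2 (λ q r → r :- (r :- q :+ (r :- q) :+ (q :- (r :- q))) := con 0ℚ) refl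

GVC⇒GVC2 : FormulatedAs GVC GVC2
GVC⇒GVC2 G w _ =
  w′
  , (λ e → ≗⇒≈ (Weights.q⁰ w′ e) 0ℝ (λ n → ℚₚ.+-inverseʳ (seq (q⁰ e) n))
         , ≗⇒≈ (Weights.q¹ w′ e) 0ℝ (λ n → q¹-vanishes (seq (q⁰ e) n) (seq (q¹ e) n)))
  , reweight-optimal w α q⁰
  where
  open Graph G
  open Weights w
  open +-*-Solver
  α : E → ℝ
  -- Annihilating q⁰ forces κ = q⁰, and α + κ = q¹ then determines α.
  α e = q¹ e - q⁰ e
  w′ = reweight w α q⁰
  q¹-vanishes : ∀ p q → q ℚ.- (q ℚ.- p ℚ.+ p) ≡ 0ℚ
  q¹-vanishes = solve 2 (λ p q → q :- (q :- p :+ p) := con 0ℚ) refl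

specialCase : ∀ P → FormulatedAs P GVC
specialCase P G w _ = w , tt , λ U opt → opt

-- Every instance of a special case is an instance of `GVC`, so `GVC1` and `GVC2` are formulated as
-- each other by the reductions of `GVC`.
restrict : ∀ P {Q} → FormulatedAs GVC Q → FormulatedAs P Q
restrict P GVC⇒Q G w _ = GVC⇒Q G w tt

theorem1 : Equivalent GVC GVC1 × Equivalent GVC GVC2 × Equivalent GVC1 GVC2
theorem1 =
    (GVC⇒GVC1 , specialCase GVC1)
  , (GVC⇒GVC2 , specialCase GVC2)
  , (restrict GVC1 GVC⇒GVC2 , restrict GVC2 GVC⇒GVC1)
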